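{- Assume $\mathsf{CH}$. Then there is a maximal $p$-filter $\mathcal{F}$ on $\mathbb{Q}$ which is $\mathbb{Q}$-basically generated.
   Context: $\mathbb{Q}$ is the set of rationals with its usual topology; $Dense(\mathbb{Q})$ is the family of dense subsets of $\mathbb{Q}$. A filter $\mathcal{F}\subseteq Dense(\mathbb{Q})$ on $\mathbb{Q}$ is a maximal filter if for every $X\in Dense(\mathbb{Q})$, either $X\in\mathcal{F}$ or there is $Y\in\mathcal{F}$ such that $X\cap Y\notin Dense(\mathbb{Q})$. A filter $\mathcal{F}$ is a $p$-filter if for every countable $\{X_n:n\in\omega\}\subseteq\mathcal{F}$ there is $X\in\mathcal{F}$ with $X\setminus X_n$ finite for all $n$. A maximal $p$-filter is a maximal filter which is a $p$-filter. A filter $\mathcal{F}$ on $\mathbb{Q}$ is $\mathbb{Q}$-basically generated if it has a base $\mathcal{B}$ such that for every sequence $\langle X_n:n\in\omega\rangle$ of elements of $\mathcal{B}$, every sequence $\langle U_n:n\in\omega\rangle$ of open subsets of $\mathbb{Q}$, every open $V\subseteq\mathbb{Q}$ and every $Y\in\mathcal{B}$ such that $\lim_{n}(X_n\cap U_n)=Y\cap V$, there are $A\in[\omega]^\omega$ and $Z\in\mathcal{B}$ such that $Z\cap V\subseteq\bigcap_{n\in A}X_n\cap V$. Limits of sequences of sets are taken in $2^{\mathbb{Q}}$ (pointwise convergence of characteristic functions). -}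

module Defs where

open import Data.Bool.Base using (Bool)
open import Data.List.Base using (List)
open import Data.List.Membership.Propositional using () renaming (_∈_ to _∈ˡ_)
open import Data.Nat.Base using (ℕ; _≥_)
open import Data.Product.Base using (Σ; Σ-syntax; ∃-syntax; _×_; proj₁)
open import Data.Rational.Base using (ℚ; 0ℚ; _-_; ∣_∣; _<_)
open import Data.Sum.Base using (_⊎_)
open import Function.Base using (_∘_)
open import Function.Bundles using (Bijection; _⇔_)
open import Induction.WellFounded using (WellFounded)
open import Level using (0ℓ; suc)
open import Relation.Binary.Core using (Rel)
open import Relation.Binary.PropositionalEquality
  using (_≡_; setoid; _→-setoid_)
open import Relation.Binary.Structures using (IsStrictTotalOrder)
open import Relation.Nullary.Negation.Core using (¬_)
open import Relation.Unary
  using (Pred; _∈_; _∉_; _⊆_; _∩_; _∖_; _≬_; ∅; U; ⋂; Satisfiable)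

Finite : {A : Set} → Pred A 0ℓ → Set
Finite {A} P = Σ[ xs ∈ List A ] P ⊆ (_∈ˡ xs)

Infinite : {A : Set} → Pred A 0ℓ → Set
Infinite P = ¬ Finite P

-- f need only be injective on P; its values elsewhere are irrelevant.
Countable : {A : Set} → Pred A 0ℓ → Set
Countable {A} P =
  Σ[ f ∈ (A → ℕ) ] (∀ {x y} → x ∈ P → y ∈ P → f x ≡ f y → x ≡ y)

-- (Ω , _≺_) has order type ω₁: an uncountable well-order all of whose proper
-- initial segments are countable.
record IsOmega₁ {Ω : Set} (_≺_ : Rel Ω 0ℓ) : Set where
  field
    isStrictTotalOrder : IsStrictTotalOrder _≡_ _≺_
    wellFounded        : WellFounded _≺_
    segmentsCountable  : ∀ α → Countable (_≺ α)
    uncountable        : ¬ Countable {Ω} U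

-- 2^ℵ₀ = ℵ₁.  Points of 2^ω are identified when pointwise equal, since function
-- extensionality is not available.
record CH : Set₁ where
  field
    Ω         : Set
    _≺_       : Rel Ω 0ℓ
    isOmega₁  : IsOmega₁ _≺_
    bijection : Bijection (setoid Ω) (ℕ →-setoid Bool)

-- Subsets of ℚ are predicates; given excluded middle these are the same as
-- points of 2^ℚ.
𝒫ℚ : Set₁
𝒫ℚ = Pred ℚ 0ℓ

Open : Pred 𝒫ℚ 0ℓ
Open O = ∀ {q} → q ∈ O →
  ∃[ ε ] 0ℚ < ε × (∀ {r} → ∣ r - q ∣ < ε → r ∈ O)

Dense : Pred 𝒫ℚ (suc 0ℓ)
Dense X = ∀ {O : 𝒫ℚ} → Open O → Satisfiable O → O ≬ X

-- Closure under supersets also makes membership in 𝓕 respect extensional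
-- equality of predicates.
record IsFilter (𝓕 : Pred 𝒫ℚ 0ℓ) : Set₁ where
  field
    whole  : U ∈ 𝓕
    proper : ∅ ∉ 𝓕
    ⊆-up   : ∀ {X Y : 𝒫ℚ} → X ∈ 𝓕 → X ⊆ Y → Y ∈ 𝓕
    ∩-meet : ∀ {X Y : 𝒫ℚ} → X ∈ 𝓕 → Y ∈ 𝓕 → X ∩ Y ∈ 𝓕

record IsMaximalFilter (𝓕 : Pred 𝒫ℚ 0ℓ) : Set₁ where
  field
    isFilter : IsFilter 𝓕
    dense    : 𝓕 ⊆ Dense
    maximal  : ∀ {X : 𝒫ℚ} → Dense X →
               X ∈ 𝓕 ⊎ Σ[ Y ∈ 𝒫ℚ ] (Y ∈ 𝓕 × ¬ Dense (X ∩ Y))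

IsPFilter : Pred 𝒫ℚ 0ℓ → Set₁
IsPFilter 𝓕 = IsFilter 𝓕 ×
  ((X : ℕ → 𝒫ℚ) → (∀ n → X n ∈ 𝓕) →
    Σ[ Y ∈ 𝒫ℚ ] (Y ∈ 𝓕 × (∀ n → Finite (Y ∖ X n))))

IsMaximalPFilter : Pred 𝒫ℚ 0ℓ → Set₁
IsMaximalPFilter 𝓕 = IsMaximalFilter 𝓕 × IsPFilter 𝓕

IsBase : Pred 𝒫ℚ 0ℓ → Pred 𝒫ℚ 0ℓ → Set₁
IsBase 𝓑 𝓕 = 𝓑 ⊆ 𝓕 ×
  (∀ {X : 𝒫ℚ} → X ∈ 𝓕 → Σ[ B ∈ 𝒫ℚ ] (B ∈ 𝓑 × B ⊆ X))

-- Pointwise convergence of characteristic functions in the discrete space 2.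
Lim : (ℕ → 𝒫ℚ) → 𝒫ℚ → Set
Lim X L = ∀ q → ∃[ N ] (∀ n → n ≥ N → (q ∈ X n ⇔ q ∈ L))

record IsℚBasicallyGenerated (𝓕 : Pred 𝒫ℚ 0ℓ) : Set₁ where
  field
    isFilter : IsFilter 𝓕
    𝓑        : Pred 𝒫ℚ 0ℓ
    isBase   : IsBase 𝓑 𝓕
    generate :
      (X : ℕ → 𝒫ℚ) → (∀ n → X n ∈ 𝓑) →
      (O : ℕ → 𝒫ℚ) → (∀ n → Open (O n)) →
      (V : 𝒫ℚ) → Open V →
      (Y : 𝒫ℚ) → Y ∈ 𝓑 →
      Lim (λ n → X n ∩ O n) (Y ∩ V) →
      Σ[ A ∈ Pred ℕ 0ℓ ] Σ[ Z ∈ 𝒫ℚ ]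
        (Infinite A × Z ∈ 𝓑 × Z ∩ V ⊆ ⋂ (Σ ℕ A) (X ∘ proj₁) ∩ V)

{-# OPTIONS --safe #-}
-- Under CH, build a ⊆*-decreasing tower of dense sets T α, indexed by ω₁, and
-- let 𝓕 be the filter it generates, which is also taken as the base.  At stage α
-- the set T α decides the α-th subset of ℚ (for maximality) and, for the α-th
-- relation R ⊆ ℚ × ℕ, if all sections of R are finite, then T α × A is disjoint
-- from R for some infinite A.
-- To generate: given X n ∩ O n → Y ∩ V, take Z ∈ 𝓕 with Z ⊆ Y and Z ⊆* X n for
-- all n.  The relation "q ∈ Z ∩ V and q ∉ X n" then has finite sections, on one
-- side because Z ⊆* X n and on the other by convergence, so some T α avoids it
-- along an infinite set of indices n.
module Submission where

open import Defs
open import Axiom.ExcludedMiddle using (ExcludedMiddle)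
open import Data.Bool.Base using (true)
open import Data.Integer.Base using (ℤ; +_; -[1+_])
open import Data.List.Base using (List; []; _∷_; _++_; length; applyDownFrom; upTo)
open import Data.List.Membership.Propositional using (lose) renaming (_∈_ to _∈ˡ_; _∉_ to _∉ˡ_)
open import Data.List.Membership.Propositional.Properties
  using (∈-++⁺ˡ; ∈-++⁺ʳ; ∈-applyDownFrom⁺; ∈-upTo⁺)
open import Data.List.Properties using (length-applyDownFrom)
open import Data.List.Relation.Unary.Any using (Any; here; there)
open import Data.Nat.Base as ℕ using (ℕ; zero; suc; _≥_)
import Data.Nat.Properties as ℕ
open import Data.Nat.Solver using (module +-*-Solver)
open import Data.Product.Base using (Σ; Σ-syntax; ∃-syntax; _×_; _,_; proj₁; proj₂)
open import Data.Rational.Base as ℚ using (ℚ; mkℚ; 0ℚ; 1ℚ; _-_; -_; _<_; ∣_∣; _⊓_)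
import Data.Rational.Properties as ℚ
open import Data.Rational.Solver renaming (module +-*-Solver to ℚ-Solver)
open import Data.Sum.Base using (_⊎_; inj₁; inj₂; [_,_]′)
open import Data.Empty using (⊥-elim)
open import Data.Unit.Base using (tt)
open import Function.Base using (_∘_; id)
open import Function.Bundles using (Bijection; Equivalence)
open import Induction.WellFounded using (WfRec; module All; module FixPoint)
open import Level using (Level; 0ℓ) renaming (suc to lsuc)
open import Relation.Binary.Definitions using (tri<; tri≈; tri>)
open import Relation.Binary.PropositionalEquality
  using (_≡_; _≢_; refl; sym; trans; cong; cong₂; subst)
open import Relation.Binary.Structures using (IsStrictTotalOrder)
open import Relation.Nullary using (yes; no; does; ¬_; contradiction)
open import Relation.Nullary.Decidable using (decidable-stable)
open import Relation.Unary
  using (Pred; _∈_; _∉_; _⊆_; _≐_; _∩_; _∪_; _∖_; ⋂; ∅; U; Satisfiable)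

private
  variable
    a : Level
    A B : Set

-- Countability

square-plus : ℕ → ℕ → ℕ
square-plus s x = s ℕ.* s ℕ.+ x

pair : ℕ → ℕ → ℕ
pair x y = square-plus (x ℕ.+ y) x

-- The values with root `s` lie between s² and s² + s, hence below (s + 1)², so the value of `pair`
-- determines the sum of its arguments.
square-plus-< : ∀ {s s′ x} x′ → x ℕ.≤ s → s ℕ.< s′ → square-plus s x ℕ.< square-plus s′ x′
square-plus-< {s} {s′} {x} x′ x≤s s<s′ = begin-strict
  s ℕ.* s ℕ.+ x              ≤⟨ ℕ.+-monoʳ-≤ (s ℕ.* s) x≤s ⟩
  s ℕ.* s ℕ.+ s              ≤⟨ ℕ.m≤m+n _ s ⟩
  s ℕ.* s ℕ.+ s ℕ.+ s        <⟨ ℕ.n<1+n _ ⟩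
  suc (s ℕ.* s ℕ.+ s ℕ.+ s)  ≡⟨ square-suc s ⟩
  suc s ℕ.* suc s            ≤⟨ ℕ.*-mono-≤ s<s′ s<s′ ⟩
  s′ ℕ.* s′                  ≤⟨ ℕ.m≤m+n _ x′ ⟩
  s′ ℕ.* s′ ℕ.+ x′           ∎
  where
  open ℕ.≤-Reasoning
  open +-*-Solver
  square-suc : ∀ s → suc (s ℕ.* s ℕ.+ s ℕ.+ s) ≡ suc s ℕ.* suc s
  square-suc = solve 1 (λ s → con 1 :+ (s :* s :+ s :+ s) := (con 1 :+ s) :* (con 1 :+ s)) refl

pair-injective : ∀ x y x′ y′ → pair x y ≡ pair x′ y′ → x ≡ x′ × y ≡ y′
pair-injective x y x′ y′ eq with ℕ.<-cmp (x ℕ.+ y) (x′ ℕ.+ y′)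
... | tri< s<s′ _ _ = contradiction eq (ℕ.<⇒≢ (square-plus-< x′ (ℕ.m≤m+n x y) s<s′))
... | tri> _ _ s>s′ = contradiction (sym eq) (ℕ.<⇒≢ (square-plus-< x (ℕ.m≤m+n x′ y′) s>s′))
... | tri≈ _ s≡s′ _ = x≡x′ , ℕ.+-cancelˡ-≡ x y y′ (trans s≡s′ (cong (ℕ._+ y′) (sym x≡x′)))
  where
  x≡x′ : x ≡ x′
  x≡x′ = ℕ.+-cancelˡ-≡ ((x ℕ.+ y) ℕ.* (x ℕ.+ y)) x x′
    (trans eq (cong (λ s → square-plus s x′) (sym s≡s′)))

×-countable : Countable {A} U → Countable {B} U → Countable {A × B} U
×-countable (f , f-inj) (g , g-inj) =
  (λ (x , y) → pair (f x) (g y)) ,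
  λ {(x , y)} {(x′ , y′)} _ _ eq →
    let (p , q) = pair-injective (f x) (g y) (f x′) (g y′) eq in cong₂ _,_ (f-inj tt tt p) (g-inj tt tt q)

ℕ-countable : Countable {ℕ} U
ℕ-countable = id , λ _ _ → id

ℤ-countable : Countable {ℤ} U
ℤ-countable = code , code-injective
  where
  code : ℤ → ℕ
  code (+ n)    = pair 0 n
  code -[1+ n ] = pair 1 n
  code-injective : ∀ {x y} → x ∈ U → y ∈ U → code x ≡ code y → x ≡ y
  code-injective {+ m}      {+ n}      _ _ eq = cong +_ (proj₂ (pair-injective 0 m 0 n eq))
  code-injective {+ m}      { -[1+ n ]} _ _ eq with () ← proj₁ (pair-injective 0 m 1 n eq)
  code-injective { -[1+ m ]} {+ n}      _ _ eq with () ← proj₁ (pair-injective 1 m 0 n eq)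
  code-injective { -[1+ m ]} { -[1+ n ]} _ _ eq = cong -[1+_] (proj₂ (pair-injective 1 m 1 n eq))

ℚ-countable : Countable {ℚ} U
ℚ-countable = code , λ _ _ → code-injective _ _
  where
  ℤ×ℕ-countable : Countable {ℤ × ℕ} U
  ℤ×ℕ-countable = ×-countable ℤ-countable ℕ-countable
  code : ℚ → ℕ
  code q = proj₁ ℤ×ℕ-countable (ℚ.numerator q , ℚ.denominator-1 q)
  code-injective : ∀ p q → code p ≡ code q → p ≡ q
  code-injective (mkℚ _ _ _) (mkℚ _ _ _) eq =
    let eq′ = proj₂ ℤ×ℕ-countable tt tt eq in ℚ.mkℚ-cong (cong proj₁ eq′) (cong proj₂ eq′)

-- Finite sets

finite-⊆ : {P Q : Pred A 0ℓ} → P ⊆ Q → Finite Q → Finite P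
finite-⊆ P⊆Q (xs , Q⊆xs) = xs , Q⊆xs ∘ P⊆Q

finite-∅ : {P : Pred A 0ℓ} → (∀ x → x ∉ P) → Finite P
finite-∅ x∉P = [] , λ x∈P → ⊥-elim (x∉P _ x∈P)

finite-∪ : {P Q : Pred A 0ℓ} → Finite P → Finite Q → Finite (P ∪ Q)
finite-∪ (xs , P⊆xs) (ys , Q⊆ys) =
  xs ++ ys , [ ∈-++⁺ˡ ∘ P⊆xs , ∈-++⁺ʳ xs ∘ Q⊆ys ]′

finite-Any : (R : A → Pred B 0ℓ) → (∀ x → Finite (R x)) →
             ∀ xs → Finite (λ y → Any (λ x → R x y) xs)
finite-Any R fin []       = finite-∅ λ _ ()
finite-Any R fin (x ∷ xs) =
  finite-⊆ (λ { (here r) → inj₁ r ; (there r) → inj₂ r }) (finite-∪ (fin x) (finite-Any R fin xs))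

list-bounded : ∀ xs → ∃[ b ] (∀ {x} → x ∈ˡ xs → x ℕ.< b)
list-bounded []       = 0 , λ ()
list-bounded (x ∷ xs) = let (b , xs<b) = list-bounded xs in
  suc x ℕ.⊔ b , λ where
    (here refl)  → ℕ.m≤m⊔n _ b
    (there x∈xs) → ℕ.<-≤-trans (xs<b x∈xs) (ℕ.m≤n⊔m _ b)

unbounded⇒infinite : {P : Pred ℕ 0ℓ} → (∀ m → ∃[ n ] n ≥ m × n ∈ P) → Infinite P
unbounded⇒infinite unb (xs , P⊆xs) =
  let (b , xs<b) = list-bounded xs ; (_ , n≥b , n∈P) = unb b in
  ℕ.<-irrefl refl (ℕ.<-≤-trans (xs<b (P⊆xs n∈P)) n≥b)

finite⇒fresh : {P : Pred ℕ 0ℓ} → Finite P → ∀ m → ∃[ n ] n ≥ m × n ∉ P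
finite⇒fresh (xs , P⊆xs) m = let (b , xs<b) = list-bounded xs in
  m ℕ.⊔ b , ℕ.m≤m⊔n m b ,
  λ n∈P → ℕ.<-irrefl refl (ℕ.<-≤-trans (xs<b (P⊆xs n∈P)) (ℕ.m≤n⊔m m b))

-- Almost inclusion

infix 4 _⊆*_
_⊆*_ : 𝒫ℚ → 𝒫ℚ → Set
X ⊆* Y = Finite (X ∖ Y)

⊆⇒⊆* : {X Y : 𝒫ℚ} → X ⊆ Y → X ⊆* Y
⊆⇒⊆* X⊆Y = finite-∅ λ _ (q∈X , q∉Y) → q∉Y (X⊆Y q∈X)

⊆*-⊆-trans : {X Y Z : 𝒫ℚ} → X ⊆* Y → Y ⊆ Z → X ⊆* Z
⊆*-⊆-trans X⊆*Y Y⊆Z = finite-⊆ (λ (q∈X , q∉Z) → q∈X , q∉Z ∘ Y⊆Z) X⊆*Y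

⊆-⊆*-trans : {X Y Z : 𝒫ℚ} → X ⊆ Y → Y ⊆* Z → X ⊆* Z
⊆-⊆*-trans X⊆Y Y⊆*Z = finite-⊆ (λ (q∈X , q∉Z) → X⊆Y q∈X , q∉Z) Y⊆*Z

-- Locally finite relations and choice along histories

LocallyFinite : (A → Pred B 0ℓ) → Set
LocallyFinite R = (∀ x → Finite (R x)) × (∀ y → Finite λ x → R x y)

-- Dependent choice where each term may depend on all earlier ones. Histories put the newest term
-- first, and the length of a history is the number of the current stage.
choose : (Good : List A → Pred A 0ℓ) → (∀ h → Satisfiable (Good h)) →
         Σ[ f ∈ (ℕ → A) ] (∀ i → f i ∈ Good (applyDownFrom f i))
choose {A} Good good = f , λ i → subst (λ h → f i ∈ Good h) (history≡ i) (proj₂ (good (history i)))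
  where
  history : ℕ → List A
  history zero    = []
  history (suc i) = proj₁ (good (history i)) ∷ history i
  f : ℕ → A
  f i = proj₁ (good (history i))
  history≡ : ∀ i → history i ≡ applyDownFrom f i
  history≡ zero    = refl
  history≡ (suc i) = cong (f i ∷_) (history≡ i)

-- The topology of ℚ

distance-positive : ∀ {p q} → p ≢ q → 0ℚ < ∣ p - q ∣
distance-positive {p} {q} p≢q with ℚ.<-cmp 0ℚ ∣ p - q ∣
... | tri< 0<d _ _ = 0<d
... | tri≈ _ 0≡d _ = contradiction p≡q p≢q
  where
  open ℚ-Solver
  p≡q : p ≡ q
  p≡q = trans (solve 2 (λ p q → p := (p :- q) :+ q) refl p q)
    (trans (cong (ℚ._+ q) (ℚ.∣p∣≡0⇒p≡0 (p - q) (sym 0≡d))) (ℚ.+-identityˡ q))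
... | tri> _ _ d<0 = contradiction (ℚ.<-≤-trans d<0 (ℚ.0≤∣p∣ (p - q))) (ℚ.<-irrefl refl)

distance-triangle : ∀ p q r → ∣ p - r ∣ ℚ.≤ ∣ p - q ∣ ℚ.+ ∣ q - r ∣
distance-triangle p q r =
  subst (λ d → ∣ d ∣ ℚ.≤ ∣ p - q ∣ ℚ.+ ∣ q - r ∣)
    (solve 3 (λ p q r → (p :- q) :+ (q :- r) := p :- r) refl p q r)
    (ℚ.∣p+q∣≤∣p∣+∣q∣ (p - q) (q - r))
  where open ℚ-Solver

Ball : ℚ × ℚ → 𝒫ℚ
Ball (q , ε) r = ∣ r - q ∣ < ε

<⇒0<- : ∀ {p q} → p < q → 0ℚ < q - p
<⇒0<- {p} {q} p<q = subst (_< q - p) (ℚ.+-inverseʳ p) (ℚ.+-monoˡ-< (- p) p<q)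

ball-open : ∀ b → Open (Ball b)
ball-open (q , ε) {r} r∈B = ε - ∣ r - q ∣ , <⇒0<- r∈B , λ {s} ∣s-r∣<δ →
  ℚ.≤-<-trans (distance-triangle s r q)
    (subst (∣ s - r ∣ ℚ.+ ∣ r - q ∣ <_)
      (solve 2 (λ x y → (x :- y) :+ y := x) refl ε ∣ r - q ∣)
      (ℚ.+-monoˡ-< ∣ r - q ∣ ∣s-r∣<δ))
  where open ℚ-Solver

ball-center : ∀ q {ε} → 0ℚ < ε → q ∈ Ball (q , ε)
ball-center q {ε} 0<ε = subst (λ d → ∣ d ∣ < ε) (sym (ℚ.+-inverseʳ q)) 0<ε

ball-other : ∀ {q ε} → 0ℚ < ε → ∃[ r ] r ∈ Ball (q , ε) × r ≢ q
ball-other {q} {ε} 0<ε = let (δ , 0<δ , δ<ε) = ℚ.<-dense 0<ε in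
  q ℚ.+ δ ,
  subst (_< ε) (trans (sym (ℚ.0≤p⇒∣p∣≡p (ℚ.<⇒≤ 0<δ))) (cong ∣_∣ (sym (shift δ)))) δ<ε ,
  λ q+δ≡q → ℚ.<-irrefl (trans (sym (ℚ.+-inverseʳ q)) (trans (cong (_- q) (sym q+δ≡q)) (shift δ))) 0<δ
  where
  open ℚ-Solver
  shift : ∀ δ → (q ℚ.+ δ) - q ≡ δ
  shift = solve 2 (λ q δ → (q :+ δ) :- q := δ) refl q

0<⊓ : ∀ {p q} → 0ℚ < p → 0ℚ < q → 0ℚ < p ⊓ q
0<⊓ {p} {q} 0<p 0<q with ℚ.⊓-sel p q
... | inj₁ eq = subst (0ℚ <_) (sym eq) 0<p
... | inj₂ eq = subst (0ℚ <_) (sym eq) 0<q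

open-punctured : ∀ {O : 𝒫ℚ} x → Open O → Open (O ∩ (_≢ x))
open-punctured x open-O {q} (q∈O , q≢x) = let (ε , 0<ε , ball⊆O) = open-O q∈O in
  ε ⊓ ∣ x - q ∣ , 0<⊓ 0<ε (distance-positive (q≢x ∘ sym)) , λ {r} near →
    ball⊆O (ℚ.<-≤-trans near (ℚ.p⊓q≤p ε _)) ,
    λ { refl → ℚ.<-irrefl refl (ℚ.<-≤-trans near (ℚ.p⊓q≤q ε _)) }

-- This is where the absence of isolated points in ℚ enters.
open-punctured-satisfiable : ∀ {O : 𝒫ℚ} x → Open O → Satisfiable O → Satisfiable (O ∩ (_≢ x))
open-punctured-satisfiable x open-O (q , q∈O) with q ℚ.≟ x
... | no q≢x   = q , q∈O , q≢x
... | yes refl = let (ε , 0<ε , ball⊆O) = open-O q∈O ; (r , r∈B , r≢q) = ball-other 0<ε in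
  r , ball⊆O r∈B , r≢q

dense-⊆ : {X Y : 𝒫ℚ} → X ⊆ Y → Dense X → Dense Y
dense-⊆ X⊆Y dense-X open-O sat-O = let (q , q∈O , q∈X) = dense-X open-O sat-O in q , q∈O , X⊆Y q∈X

-- Each listed point is deleted from the open set rather than from `X`: a nonempty open set stays
-- open and nonempty when it loses one point.
dense-∖-list : {X : 𝒫ℚ} → Dense X → ∀ xs → Dense (X ∩ (_∉ˡ xs))
dense-∖-list dense-X []       = dense-⊆ (λ q∈X → q∈X , λ ()) dense-X
dense-∖-list dense-X (x ∷ xs) open-O sat-O =
  let (q , (q∈O , q≢x) , (q∈X , q∉xs)) = dense-∖-list dense-X xs
        (open-punctured x open-O) (open-punctured-satisfiable x open-O sat-O)
  in q , q∈O , q∈X , λ { (here q≡x) → q≢x q≡x ; (there q∈xs) → q∉xs q∈xs }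

dense-U : Dense U
dense-U _ (q , q∈O) = q , q∈O , tt

dense-∖ : {X F : 𝒫ℚ} → Dense X → Finite F → Dense (X ∖ F)
dense-∖ dense-X (xs , F⊆xs) =
  dense-⊆ (λ (q∈X , q∉xs) → q∈X , q∉xs ∘ F⊆xs) (dense-∖-list dense-X xs)

-- Classical facts on almost inclusion and enumerations

module Classical (em : ∀ ℓ → ExcludedMiddle ℓ) where

  stable : {P : Set a} → ¬ ¬ P → P
  stable {P = P} = decidable-stable (em _ {P})

  dense-⊆* : {X Y : 𝒫ℚ} → Dense X → X ⊆* Y → Dense Y
  dense-⊆* dense-X X⊆*Y =
    dense-⊆ (λ (q∈X , q∉X∖Y) → stable λ q∉Y → q∉X∖Y (q∈X , q∉Y)) (dense-∖ dense-X X⊆*Y)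

  ⊆*-trans : {X Y Z : 𝒫ℚ} → X ⊆* Y → Y ⊆* Z → X ⊆* Z
  ⊆*-trans {X} {Y} {Z} X⊆*Y Y⊆*Z = finite-⊆ split (finite-∪ X⊆*Y Y⊆*Z)
    where
    split : X ∖ Z ⊆ (X ∖ Y) ∪ (Y ∖ Z)
    split {q} (q∈X , q∉Z) with em _ {q ∈ Y}
    ... | yes q∈Y = inj₂ (q∈Y , q∉Z)
    ... | no  q∉Y = inj₁ (q∈X , q∉Y)

  ⊆*-∩ : {X Y Z : 𝒫ℚ} → X ⊆* Y → X ⊆* Z → X ⊆* Y ∩ Z
  ⊆*-∩ {X} {Y} {Z} X⊆*Y X⊆*Z = finite-⊆ split (finite-∪ X⊆*Y X⊆*Z)
    where
    split : X ∖ (Y ∩ Z) ⊆ (X ∖ Y) ∪ (X ∖ Z)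
    split {q} (q∈X , q∉Y∩Z) with em _ {q ∈ Y}
    ... | yes q∈Y = inj₂ (q∈X , λ q∈Z → q∉Y∩Z (q∈Y , q∈Z))
    ... | no  q∉Y = inj₁ (q∈X , q∉Y)

  enumerate : {P : Pred A 0ℓ} → Countable P → Satisfiable P →
              Σ[ e ∈ (ℕ → A) ] (∀ i → e i ∈ P) × (∀ {x} → x ∈ P → ∃[ i ] e i ≡ x)
  enumerate {A = A} {P = P} (f , f-inj) (x₀ , x₀∈P) =
    proj₁ ∘ decode , (λ i → proj₁ (proj₂ (decode i))) , λ {x} x∈P →
      let (y , y∈P , fy≡fx) = decode (f x) in
      f x , f-inj y∈P x∈P (fy≡fx (x , x∈P , refl))
    where
    Preimage : ℕ → Set
    Preimage i = Σ[ x ∈ A ] x ∈ P × f x ≡ i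
    decode : ∀ i → Σ[ x ∈ A ] x ∈ P × (Preimage i → f x ≡ i)
    decode i with em _ {Preimage i}
    ... | yes (x , x∈P , fx≡i) = x , x∈P , λ _ → fx≡i
    -- Numbers that code no element of `P` go to the default `x₀`, so the enumeration is total and
    -- may repeat values.
    ... | no ¬pre              = x₀ , x₀∈P , λ pre → ⊥-elim (¬pre pre)

  opaque
    -- Balls with rational centre and radius form a countable base, so density becomes a countable
    -- list of requirements.
    basis : Σ[ e ∈ (ℕ → ℚ × ℚ) ] (∀ i → 0ℚ < proj₂ (e i)) ×
            (∀ {b} → 0ℚ < proj₂ b → ∃[ i ] e i ≡ b)
    basis = let (f , f-inj) = ×-countable ℚ-countable ℚ-countable in
      enumerate (f , λ _ _ → f-inj tt tt) ((0ℚ , 1ℚ) , ℚ.positive⁻¹ 1ℚ)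

  -- Dense pseudointersections that avoid a locally finite relation

  module _ {D : ℕ → 𝒫ℚ} (dense-D : ∀ i → Dense (D i)) (D-decreasing : ∀ {i j} → i ℕ.≤ j → D j ⊆ D i)
           {R : ℚ → Pred ℕ 0ℓ} (R-finite : LocallyFinite R) where

    private
      ball : ℕ → ℚ × ℚ
      ball = proj₁ basis

      -- The stage is `length h`. The bound on `n` will make the index set infinite, the ball gives
      -- density, and `D` gives almost inclusion. The last list includes the new pair because `t`
      -- must also avoid the index of its own stage.
      Good : List (ℚ × ℕ) → Pred (ℚ × ℕ) 0ℓ
      Good h (t , n) =
        n ≥ length h × ¬ Any (λ x → R (proj₁ x) n) h ×
        t ∈ Ball (ball (length h)) × t ∈ D (length h) × ¬ Any (λ x → R t (proj₂ x)) ((t , n) ∷ h)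

      good : ∀ h → Satisfiable (Good h)
      good h =
        let i = length h
            (n , n≥i , ¬Rn) = finite⇒fresh (finite-Any (R ∘ proj₁) (proj₁ R-finite ∘ proj₁) h) i
            (t , t∈B , t∈D , ¬Rt) =
              dense-∖ (dense-D i)
                -- The index `n` is fixed before the point. The entry `0ℚ` is a placeholder: only
                -- second components matter here.
                (finite-Any (λ x t → R t (proj₂ x)) (proj₂ R-finite ∘ proj₂) ((0ℚ , n) ∷ h))
                (ball-open (ball i)) (proj₁ (ball i) , ball-center (proj₁ (ball i)) (proj₁ (proj₂ basis) i))
        in (t , n) , n≥i , ¬Rn , t∈B , t∈D , λ { (here r) → ¬Rt (here r) ; (there r) → ¬Rt (there r) }

      opaque
        sequence : Σ[ f ∈ (ℕ → ℚ × ℕ) ] (∀ i → f i ∈ Good (applyDownFrom f i))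
        sequence = choose Good good
      t : ℕ → ℚ
      t = proj₁ ∘ proj₁ sequence
      n : ℕ → ℕ
      n = proj₂ ∘ proj₁ sequence

    opaque
      -- Points t i ∈ D i of the i-th basic ball and indices n i are chosen
      -- alternately, each avoiding the R-sections of the earlier choices.
      dense-avoiding-pseudointersection :
        Σ[ P ∈ 𝒫ℚ ] Σ[ A ∈ Pred ℕ 0ℓ ]
          Dense P × (∀ i → P ⊆* D i) × Infinite A × (∀ {q m} → q ∈ P → m ∈ A → ¬ R q m)
      dense-avoiding-pseudointersection =
        P , (λ m → ∃[ i ] m ≡ n i) , P-dense , P⊆*D ,
        unbounded⇒infinite (λ m → n m , n≥ m , m , refl) ,
        λ { (i , refl) (j , refl) → avoids i j }
        where
        P : 𝒫ℚ
        P q = ∃[ i ] q ≡ t i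
        spec : ∀ i → Good (applyDownFrom (proj₁ sequence) i) (t i , n i)
        spec = proj₂ sequence
        len : ∀ i → length (applyDownFrom (proj₁ sequence) i) ≡ i
        len = length-applyDownFrom (proj₁ sequence)
        n≥ : ∀ i → n i ≥ i
        n≥ i = let (n≥l , _) = spec i in subst (n i ≥_) (len i) n≥l
        t∈B : ∀ i → t i ∈ Ball (ball i)
        t∈B i = let (_ , _ , t∈ , _) = spec i in subst (λ l → t i ∈ Ball (ball l)) (len i) t∈
        t∈D : ∀ i → t i ∈ D i
        t∈D i = let (_ , _ , _ , t∈ , _) = spec i in subst (λ l → t i ∈ D l) (len i) t∈
        earlier : ∀ {i j} → i ℕ.< j → (t i , n i) ∈ˡ applyDownFrom (proj₁ sequence) j
        earlier = ∈-applyDownFrom⁺ (proj₁ sequence)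
        n-fresh : ∀ j → ¬ Any (λ x → R (proj₁ x) (n j)) (applyDownFrom (proj₁ sequence) j)
        n-fresh j = proj₁ (proj₂ (spec j))
        t-fresh : ∀ i → ¬ Any (λ x → R (t i) (proj₂ x)) ((t i , n i) ∷ applyDownFrom (proj₁ sequence) i)
        t-fresh i = proj₂ (proj₂ (proj₂ (proj₂ (spec i))))
        avoids : ∀ i j → ¬ R (t i) (n j)
        avoids i j r with ℕ.<-cmp i j
        ... | tri< i<j _ _  = n-fresh j (lose (earlier i<j) r)
        ... | tri≈ _ refl _ = t-fresh i (here r)
        ... | tri> _ _ j<i  = t-fresh i (there (lose (earlier j<i) r))
        P-dense : Dense P
        P-dense {O} open-O (q , q∈O) =
          let (ε , 0<ε , ball⊆O) = open-O q∈O ; (i , e≡) = proj₂ (proj₂ basis) {q , ε} 0<ε in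
          t i , ball⊆O {t i} (subst (λ b → t i ∈ Ball b) e≡ (t∈B i)) , i , refl
        P⊆*D : ∀ i → P ⊆* D i
        P⊆*D i = applyDownFrom t i , λ where
          -- For j ≥ i the point `t j` lies in `D j`, hence in `D i`, so exceptions occur only among
          -- the first `i` points.
          ((j , refl) , tj∉D) → ∈-applyDownFrom⁺ t (ℕ.≰⇒> λ i≤j → tj∉D (D-decreasing i≤j (t∈D j)))

  -- The tower

  module Tower (ch : CH) where

    open CH ch
    open IsOmega₁ isOmega₁
    open IsStrictTotalOrder isStrictTotalOrder using (compare)

    -- Coding sets and relations by elements of Ω

    private
      -- Through the bijection, `x` is a binary sequence, read at the positions `f y`. Other
      -- positions are ignored, so a subset may have several codes.
      Decoded : Countable {A} U → Ω → Pred A 0ℓ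
      Decoded (f , _) x y = Bijection.to bijection x (f y) ≡ true

      encode : (c : Countable {A} U) (P : Pred A 0ℓ) → ∃[ x ] Decoded c x ≐ P
      encode {A} (f , f-inj) P = proj₁ preimage , decode⊆ , decode⊇
        where
        Code : Pred ℕ 0ℓ
        Code m = Σ[ y ∈ A ] f y ≡ m × y ∈ P
        preimage : ∃[ x ] (∀ {z} → z ≡ x → ∀ m → Bijection.to bijection z m ≡ does (em 0ℓ {Code m}))
        preimage = Bijection.surjective bijection (λ m → does (em 0ℓ {Code m}))
        decode⊆ : Decoded (f , f-inj) (proj₁ preimage) ⊆ P
        decode⊆ {y} bit with em 0ℓ {Code (f y)} | proj₂ preimage refl (f y)
        ... | yes (y′ , fy′≡fy , y′∈P) | _ = subst P (f-inj tt tt fy′≡fy) y′∈P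
        ... | no _ | bit≡false with () ← trans (sym bit) bit≡false
        decode⊇ : P ⊆ Decoded (f , f-inj) (proj₁ preimage)
        decode⊇ {y} y∈P with em 0ℓ {Code (f y)} | proj₂ preimage refl (f y)
        ... | yes _    | bit≡true = bit≡true
        ... | no ¬code | _        = ⊥-elim (¬code (y , refl , y∈P))

    opaque
      set : Ω → 𝒫ℚ
      set = Decoded ℚ-countable

      set-surjective : ∀ (X : 𝒫ℚ) → ∃[ x ] set x ≐ X
      set-surjective = encode ℚ-countable

      relation : Ω → Pred (ℚ × ℕ) 0ℓ
      relation = Decoded (×-countable ℚ-countable ℕ-countable)

      relation-surjective : ∀ (R : Pred (ℚ × ℕ) 0ℓ) → ∃[ x ] relation x ≐ R
      relation-surjective = encode (×-countable ℚ-countable ℕ-countable)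

    Related : Ω → ℚ → Pred ℕ 0ℓ
    Related x q n = (q , n) ∈ relation x

    -- Least elements in the well-order

    IsLeast : Pred Ω a → Pred Ω a
    IsLeast P x = x ∈ P × (∀ {y} → y ∈ P → ¬ y ≺ x)

    least-exists : {P : Pred Ω a} → Satisfiable P → Satisfiable (IsLeast P)
    least-exists {a} {P} (x , x∈P) = All.wfRec wellFounded a (λ x → x ∈ P → Satisfiable (IsLeast P)) step x x∈P
      where
      step : ∀ x → (∀ {y} → y ≺ x → y ∈ P → Satisfiable (IsLeast P)) → x ∈ P → Satisfiable (IsLeast P)
      step x rec x∈P with em _ {∃[ y ] y ≺ x × y ∈ P}
      ... | yes (y , y≺x , y∈P) = rec y≺x y∈P
      ... | no ¬smaller         = x , x∈P , λ y∈P y≺x → ¬smaller (_ , y≺x , y∈P)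

    -- The default makes the choice total, so the recursion can be defined before its stages are
    -- known to be satisfiable.
    least : Pred Ω a → Ω → Ω
    least P default with em _ {Satisfiable (IsLeast P)}
    ... | yes (x , _) = x
    ... | no _        = default

    least-∈ : {P : Pred Ω a} {d : Ω} → Satisfiable P → least P d ∈ P
    least-∈ {P = P} sat with em _ {Satisfiable (IsLeast P)}
    ... | yes (_ , x∈P , _) = x∈P
    ... | no ¬least         = ⊥-elim (¬least (least-exists sat))

    isLeast-resp-≐ : {P Q : Pred Ω a} → P ≐ Q → IsLeast P ⊆ IsLeast Q
    isLeast-resp-≐ (P⊆Q , Q⊆P) (x∈P , x-min) = P⊆Q x∈P , x-min ∘ Q⊆P

    least-cong : {P Q : Pred Ω a} {d : Ω} → P ≐ Q → least P d ≡ least Q d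
    least-cong {P = P} {Q} P≐Q with em _ {Satisfiable (IsLeast P)} | em _ {Satisfiable (IsLeast Q)}
    ... | no _ | no _ = refl
    ... | yes (x , least-x) | no ¬least = ⊥-elim (¬least (x , isLeast-resp-≐ P≐Q least-x))
    ... | no ¬least | yes (y , least-y) = ⊥-elim (¬least (y , isLeast-resp-≐ (proj₂ P≐Q , proj₁ P≐Q) least-y))
    ... | yes (x , x∈P , x-min) | yes (y , y∈Q , y-min) with compare x y
    ...   | tri< x≺y _ _ = ⊥-elim (y-min (proj₁ P≐Q x∈P) x≺y)
    ...   | tri≈ _ x≡y _ = x≡y
    ...   | tri> _ _ y≺x = ⊥-elim (x-min (proj₂ P≐Q y∈Q) y≺x)

    -- Requirements on a stage and the transfinite recursion

    Decides : Ω → Pred 𝒫ℚ (lsuc 0ℓ)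
    Decides α P = P ⊆ set α ⊎ ¬ Dense (set α ∩ P)

    decides-⊆ : ∀ {α} {P Q : 𝒫ℚ} → Q ⊆ P → Decides α P → Decides α Q
    decides-⊆ Q⊆P (inj₁ P⊆α)   = inj₁ λ q∈Q → P⊆α (Q⊆P q∈Q)
    decides-⊆ Q⊆P (inj₂ ¬dense) = inj₂ (¬dense ∘ dense-⊆ λ (q∈α , q∈Q) → q∈α , Q⊆P q∈Q)

    -- With local finiteness as a premise, `α` may range over codes of arbitrary relations.
    Avoids : Ω → Pred 𝒫ℚ (lsuc 0ℓ)
    Avoids α P = LocallyFinite (Related α) →
      Σ[ A ∈ Pred ℕ 0ℓ ] Infinite A × (∀ {q n} → q ∈ P → n ∈ A → ¬ Related α q n)

    Stage : ∀ α → WfRec _≺_ (λ _ → Ω) α → Pred Ω (lsuc 0ℓ)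
    Stage α earlier x =
      (∀ {β} (β≺α : β ≺ α) → set x ⊆* set (earlier β≺α)) × Dense (set x) × Decides α (set x) × Avoids α (set x)

    -- The least code is chosen, rather than an arbitrary one, because it depends
    -- only on the values of the earlier stages; this is what the recursion
    -- equation needs in the absence of function extensionality.
    step : ∀ α → WfRec _≺_ (λ _ → Ω) α → Ω
    step α earlier = least (Stage α earlier) α

    step-ext : ∀ α {e e′ : WfRec _≺_ (λ _ → Ω) α} →
               (∀ {β} (β≺α : β ≺ α) → e β≺α ≡ e′ β≺α) → step α e ≡ step α e′
    step-ext α e≡e′ = least-cong
      ( (λ {x} (below , rest) → (λ β≺α → subst (λ y → set x ⊆* set y) (e≡e′ β≺α) (below β≺α)) , rest)
      , (λ {x} (below , rest) → (λ β≺α → subst (λ y → set x ⊆* set y) (sym (e≡e′ β≺α)) (below β≺α)) , rest))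

    opaque
      T-code : Ω → Ω
      T-code = All.wfRec wellFounded 0ℓ (λ _ → Ω) step

      T-code-unfold : ∀ α → T-code α ≡ step α (λ {β} _ → T-code β)
      T-code-unfold _ = FixPoint.unfold-wfRec wellFounded (λ _ → Ω) step step-ext

    T : Ω → 𝒫ℚ
    T = set ∘ T-code

    -- The later of two sets in a decreasing chain is almost included in both. The parameter `P`
    -- covers the segment below `α`, while the tower is still being built, as well as all of Ω.
    T-directed : {P : Pred Ω 0ℓ} → (∀ {β γ} → γ ∈ P → β ≺ γ → T γ ⊆* T β) →
                 ∀ {β γ} → β ∈ P → γ ∈ P → ∃[ δ ] δ ∈ P × T δ ⊆* T β ∩ T γ
    T-directed T-decreasing {β} {γ} β∈P γ∈P with compare β γ
    ... | tri< β≺γ _ _  = γ , γ∈P , ⊆*-∩ (T-decreasing γ∈P β≺γ) (⊆⇒⊆* id)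
    ... | tri≈ _ refl _ = β , β∈P , ⊆⇒⊆* λ q∈T → q∈T , q∈T
    ... | tri> _ _ γ≺β  = β , β∈P , ⊆*-∩ (⊆⇒⊆* id) (T-decreasing β∈P γ≺β)

    IsStage : Pred Ω (lsuc 0ℓ)
    IsStage α = Stage α (λ {β} _ → T-code β) (T-code α)

    -- Extending the tower by one stage

    module Extend (α : Ω) (stages : ∀ {β} → β ≺ α → IsStage β) where

      private
        index = proj₁ (segmentsCountable α)

        -- Since `index` is injective below `α`, this intersects only finitely many tower sets. It
        -- replaces the countable tower below `α` by a decreasing sequence indexed by ℕ.
        Meet : ℕ → 𝒫ℚ
        Meet i q = ∀ β → β ≺ α → index β ℕ.< i → q ∈ T β

        -- At most one stage has index `i`, so each induction step adds at most one set to the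
        -- intersection. Carrying `T γ` along strengthens the induction hypothesis enough to absorb
        -- it.
        Meet-directed : ∀ i {γ} → γ ≺ α → ∃[ δ ] δ ≺ α × T δ ⊆* Meet i ∩ T γ
        Meet-directed zero {γ} γ≺α = γ , γ≺α , ⊆⇒⊆* λ q∈T → (λ _ _ ()) , q∈T
        Meet-directed (suc i) {γ} γ≺α with em _ {∃[ β ] β ≺ α × index β ≡ i}
        ... | no ¬hit =
          let (δ , δ≺α , Tδ⊆*) = Meet-directed i γ≺α in
          δ , δ≺α , ⊆*-⊆-trans Tδ⊆* λ (q∈M , q∈Tγ) →
            (λ β β≺α β<1+i → q∈M β β≺α (ℕ.≤∧≢⇒< (ℕ.≤-pred β<1+i) λ β≡i → ¬hit (β , β≺α , β≡i))) , q∈Tγ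
        ... | yes (β , β≺α , β≡i) =
          -- First `T β` and `T γ` get a common lower bound `T η`; the induction hypothesis is then
          -- applied to `η` in place of `γ`.
          let (η , η≺α , Tη⊆*) = T-directed (λ γ≺α → proj₁ (stages γ≺α)) β≺α γ≺α
              (δ , δ≺α , Tδ⊆*) = Meet-directed i η≺α
              Tδ⊆*′ = ⊆*-∩ (⊆*-⊆-trans Tδ⊆* proj₁) (⊆*-trans (⊆*-⊆-trans Tδ⊆* proj₂) Tη⊆*)
          in δ , δ≺α , ⊆*-⊆-trans Tδ⊆*′ λ {q} (q∈M , q∈Tβ , q∈Tγ) →
            (λ β′ β′≺α β′<1+i → [ q∈M β′ β′≺α
                                  , (λ β′≡i → subst (λ β → q ∈ T β)
                                      (proj₂ (segmentsCountable α) β≺α β′≺α (trans β≡i (sym β′≡i))) q∈Tβ)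
                                  ]′ (ℕ.m≤n⇒m<n∨m≡n (ℕ.≤-pred β′<1+i))) , q∈Tγ

        Meet-dense : ∀ i → Dense (Meet i)
        Meet-dense i with em _ {∃[ γ ] γ ≺ α}
        -- With nothing below `α`, the intersection is all of ℚ.
        ... | no ¬γ         = dense-⊆ (λ _ β β≺α → ⊥-elim (¬γ (β , β≺α))) dense-U
        ... | yes (_ , γ≺α) =
          let (δ , δ≺α , Tδ⊆*) = Meet-directed i γ≺α in
          dense-⊆* (proj₁ (proj₂ (stages δ≺α))) (⊆*-⊆-trans Tδ⊆* proj₁)

        Meet-decreasing : ∀ {i j} → i ℕ.≤ j → Meet j ⊆ Meet i
        Meet-decreasing i≤j q∈M β β≺α β<i = q∈M β β≺α (ℕ.<-≤-trans β<i i≤j)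

        -- If the relation coded by `α` is not locally finite, the empty relation takes its place
        -- and the requirement of avoidance holds vacuously.
        avoided : Σ[ R ∈ (ℚ → Pred ℕ 0ℓ) ] LocallyFinite R ×
                  (LocallyFinite (Related α) → ∀ {q n} → Related α q n → R q n)
        avoided with em _ {LocallyFinite (Related α)}
        ... | yes fin = Related α , fin , λ _ r → r
        ... | no ¬fin = (λ _ → ∅) , ((λ _ → finite-∅ λ _ ()) , λ _ → finite-∅ λ _ ()) ,
                        λ fin → ⊥-elim (¬fin fin)

        refine : {P : 𝒫ℚ} → Dense P → ∃[ Q ] Q ⊆ P × Dense Q × Decides α Q
        refine {P} dense-P with em _ {Dense (set α ∩ P)}
        ... | yes dense-S∩P = set α ∩ P , proj₂ , dense-S∩P , inj₁ proj₁
        ... | no ¬dense     = P , id , dense-P , inj₂ ¬dense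

      next-stage : Satisfiable (Stage α (λ {β} _ → T-code β))
      next-stage
        with (R , R-finite , related⇒R) ← avoided
        with (P , A , dense-P , P⊆*Meet , infinite-A , P-avoids)
               ← dense-avoiding-pseudointersection Meet-dense Meet-decreasing R-finite
        -- Deciding can come last: passing to a subset preserves almost inclusion, and avoidance
        -- with the same `A`.
        with (Q , Q⊆P , dense-Q , Q-decides) ← refine dense-P
        with (x , x⊆Q , Q⊆x) ← set-surjective Q
        = x , below , dense-⊆ Q⊆x dense-Q , decides-⊆ x⊆Q Q-decides ,
          λ finite → A , infinite-A , λ q∈x n∈A r → P-avoids (Q⊆P (x⊆Q q∈x)) n∈A (related⇒R finite r)
        where
        below : ∀ {β} → β ≺ α → set x ⊆* T β
        below {β} β≺α = ⊆-⊆*-trans (λ q∈x → Q⊆P (x⊆Q q∈x))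
          -- The successor is needed because `Meet` bounds indices strictly.
          (⊆*-⊆-trans (P⊆*Meet (suc (index β))) λ q∈M → q∈M β β≺α ℕ.≤-refl)

    -- Once all earlier values meet their requirements, an admissible code exists at `α`, so `least`
    -- does not fall back on its default.
    isStage : ∀ α → IsStage α
    isStage = All.wfRec wellFounded (lsuc 0ℓ) IsStage λ α stages →
      subst (Stage α (λ {β} _ → T-code β)) (sym (T-code-unfold α)) (least-∈ (Extend.next-stage α stages))

    T-decreasing : ∀ {β γ} → β ≺ γ → T γ ⊆* T β
    T-decreasing {γ = γ} = proj₁ (isStage γ)

    T-dense : ∀ α → Dense (T α)
    T-dense α = proj₁ (proj₂ (isStage α))

    T-decides : ∀ α → Decides α (T α)
    T-decides α = proj₁ (proj₂ (proj₂ (isStage α)))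

    T-avoids : ∀ α → Avoids α (T α)
    T-avoids α = proj₂ (proj₂ (proj₂ (isStage α)))

    -- Otherwise every `β` lies below some `α n`, and the pair of such an `n` with the index of `β`
    -- below `α n` injects Ω into ℕ.
    not-cofinal : (α : ℕ → Ω) → ∃[ β ] (∀ n → ¬ β ≺ α n)
    not-cofinal α = stable λ ¬bound → uncountable (countable ¬bound)
      where
      code : ℕ → Ω → ℕ
      code n = proj₁ (segmentsCountable (α n))
      code-injective : ∀ {m n β γ} → m ≡ n → β ≺ α m → γ ≺ α n → code m β ≡ code n γ → β ≡ γ
      code-injective {m} refl = proj₂ (segmentsCountable (α m))
      countable : ¬ (∃[ β ] (∀ n → ¬ β ≺ α n)) → Countable {Ω} U
      countable ¬bound = (λ β → pair (level β) (code (level β) β)) , λ {β} {γ} _ _ eq →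
        let (level≡ , code≡) = pair-injective (level β) (code (level β) β) (level γ) (code (level γ) γ) eq in
        code-injective level≡ (below β) (below γ) code≡
        where
        hit : ∀ β → ∃[ n ] β ≺ α n
        hit β = stable λ ¬hit → ¬bound (β , λ n β≺α → ¬hit (n , β≺α))
        level = proj₁ ∘ hit
        below = proj₂ ∘ hit

    -- The filter

    𝓕 : Pred 𝒫ℚ 0ℓ
    𝓕 X = ∃[ α ] T α ⊆* X

    T∈𝓕 : ∀ α → T α ∈ 𝓕
    T∈𝓕 α = α , ⊆⇒⊆* id

    𝓕-dense : 𝓕 ⊆ Dense
    𝓕-dense (α , Tα⊆*X) = dense-⊆* (T-dense α) Tα⊆*X

    𝓕-isFilter : IsFilter 𝓕
    𝓕-isFilter = record
      -- Any stage would do; a code of ℚ supplies an element of Ω.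
      { whole  = proj₁ (set-surjective U) , ⊆⇒⊆* _
      ; proper = λ ∅∈𝓕 → proj₂ (proj₂ (𝓕-dense ∅∈𝓕 {U} (λ _ → 1ℚ , ℚ.positive⁻¹ 1ℚ , _) (0ℚ , _)))
      ; ⊆-up   = λ (α , Tα⊆*X) X⊆Y → α , ⊆*-⊆-trans Tα⊆*X X⊆Y
      ; ∩-meet = λ (α , Tα⊆*X) (β , Tβ⊆*Y) →
          let (γ , _ , Tγ⊆*) = T-directed {U} (λ _ → T-decreasing) {α} {β} _ _ in
          γ , ⊆*-∩ (⊆*-trans (⊆*-⊆-trans Tγ⊆* proj₁) Tα⊆*X) (⊆*-trans (⊆*-⊆-trans Tγ⊆* proj₂) Tβ⊆*Y)
      }

    open IsFilter 𝓕-isFilter using (∩-meet)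

    𝓕-isMaximalFilter : IsMaximalFilter 𝓕
    𝓕-isMaximalFilter = record
      { isFilter = 𝓕-isFilter
      ; dense    = 𝓕-dense
      ; maximal  = λ {X} _ → let (α , α⊆X , X⊆α) = set-surjective X in maximal α⊆X X⊆α (T-decides α)
      }
      where
      maximal : ∀ {X α} → set α ⊆ X → X ⊆ set α → Decides α (T α) →
                X ∈ 𝓕 ⊎ Σ[ Y ∈ 𝒫ℚ ] (Y ∈ 𝓕 × ¬ Dense (X ∩ Y))
      maximal {α = α} α⊆X _ (inj₁ T⊆α)    = inj₁ (α , ⊆⇒⊆* λ q∈T → α⊆X (T⊆α q∈T))
      maximal {α = α} _ X⊆α (inj₂ ¬dense) =
        inj₂ (T α , T∈𝓕 α , ¬dense ∘ dense-⊆ λ (q∈X , q∈T) → X⊆α q∈X , q∈T)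

    -- Countably many members of the filter have countably many witnessing stages. These are not
    -- cofinal in Ω, and a tower set at or beyond all of them is almost included in every `X n`.
    pseudointersection : (X : ℕ → 𝒫ℚ) → (∀ n → X n ∈ 𝓕) →
                         Σ[ Y ∈ 𝒫ℚ ] (Y ∈ 𝓕 × (∀ n → Y ⊆* X n))
    pseudointersection X X∈𝓕 =
      let (β , β⊀α) = not-cofinal (proj₁ ∘ X∈𝓕) in
      T β , T∈𝓕 β , λ n → ⊆*-trans (below β (β⊀α n)) (proj₂ (X∈𝓕 n))
      where
      below : ∀ β {α} → ¬ β ≺ α → T β ⊆* T α
      below β {α} β⊀α with compare β α
      ... | tri< β≺α _ _  = ⊥-elim (β⊀α β≺α)
      ... | tri≈ _ refl _ = ⊆⇒⊆* id
      ... | tri> _ _ α≺β  = T-decreasing α≺β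

    𝓕-isPFilter : IsPFilter 𝓕
    𝓕-isPFilter = 𝓕-isFilter , pseudointersection

    -- Generation from a convergent sequence

    module Generate {X O : ℕ → 𝒫ℚ} {V Y Z : 𝒫ℚ} (lim : Lim (λ n → X n ∩ O n) (Y ∩ V))
                    (Z∈𝓕 : Z ∈ 𝓕) (Z⊆*X : ∀ n → Z ⊆* X n) (Y∈𝓕 : Y ∈ 𝓕) where

      -- Membership in `Y` is a clause of the relation, so `Z` itself need not be shrunk into `Y`
      -- beforehand.
      Missed : Pred (ℚ × ℕ) 0ℓ
      Missed (q , n) = (q ∈ Z × q ∈ Y × q ∈ V) × q ∉ X n

      Missed-finite : LocallyFinite (λ q n → Missed (q , n))
      Missed-finite = by-point , λ n → finite-⊆ (λ ((q∈Z , _) , q∉X) → q∈Z , q∉X) (Z⊆*X n)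
        where
        by-point : ∀ q → Finite (λ n → Missed (q , n))
        by-point q = let (N , eventually) = lim q in
          -- From `N` on, a point of Y ∩ V lies in `X n`, so only indices below `N` can miss it.
          upTo N , λ ((_ , q∈Y , q∈V) , q∉X) → ∈-upTo⁺ (ℕ.≰⇒> λ N≤n →
            q∉X (proj₁ (Equivalence.from (eventually _ N≤n) (q∈Y , q∈V))))

      generated : Σ[ A ∈ Pred ℕ 0ℓ ] Σ[ W ∈ 𝒫ℚ ]
                    (Infinite A × W ∈ 𝓕 × W ∩ V ⊆ ⋂ (Σ ℕ A) (X ∘ proj₁) ∩ V)
      generated =
        let (α , α⊆Missed , Missed⊆α) = relation-surjective Missed
            (A , infinite-A , avoids) = T-avoids α
              ( (λ q → finite-⊆ α⊆Missed (proj₁ Missed-finite q))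
              , (λ n → finite-⊆ α⊆Missed (proj₂ Missed-finite n)))
        -- The factors `Z` and `Y`, together with `V`, make any failure q ∉ X n an instance of
        -- `Missed`; the factor `T α` excludes it for n in `A`.
        in A , Z ∩ Y ∩ T α , infinite-A , ∩-meet Z∈𝓕 (∩-meet Y∈𝓕 (T∈𝓕 α)) ,
           λ ((q∈Z , q∈Y , q∈T) , q∈V) →
             (λ (n , n∈A) → stable λ q∉X → avoids q∈T n∈A (Missed⊆α ((q∈Z , q∈Y , q∈V) , q∉X))) , q∈V

    𝓕-isℚBasicallyGenerated : IsℚBasicallyGenerated 𝓕
    𝓕-isℚBasicallyGenerated = record
      { isFilter = 𝓕-isFilter
      ; 𝓑        = 𝓕
      ; isBase   = id , λ {X} X∈𝓕 → X , X∈𝓕 , id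
      ; generate = λ X X∈𝓕 _ _ _ _ _ Y∈𝓕 lim →
          let (_ , Z∈𝓕 , Z⊆*X) = pseudointersection X X∈𝓕 in
          Generate.generated lim Z∈𝓕 Z⊆*X Y∈𝓕
      }

proposition2p31 : (∀ ℓ → ExcludedMiddle ℓ) → CH → Σ[ 𝓕 ∈ Pred 𝒫ℚ 0ℓ ] (IsMaximalPFilter 𝓕 × IsℚBasicallyGenerated 𝓕)
proposition2p31 em ch = 𝓕 , (𝓕-isMaximalFilter , 𝓕-isPFilter) , 𝓕-isℚBasicallyGenerated
  where
  open Classical em
  open Tower ch
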